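{- Let $n\in\mathbb{N}$ and let $\mathcal{L}$ be a finite set of rectangular polyominoes such that at most one element of $\mathcal{L}$ has unit height, every other element of $\mathcal{L}$ has height $>n/2$, and the polyomino of unit height has width dividing the greatest common divisor of the widths of all the other polyominoes in $\mathcal{L}$. Then $\mathcal{L}$ is strongly $n$-Noetherian. Furthermore, $\beta_n(\mathcal{L})$ equals the largest width of any polyomino in $\mathcal{L}$.
   Context: A polyomino is a region of $\mathbb{R}^2$ made of unit squares joined along coincident edges, considered up to translation. $R_{n\times m}$ denotes the rectangular region of height $n$ and width $m$. A tiling of $R_{n\times m}$ by a multiset $T$ of polyominoes is a placement of translates of all elements of $T$ in $R_{n\times m}$ covering every point, with no two different elements having two-dimensional overlap; a tiling by elements of $\mathcal{L}$ is a tiling by a multiset with elements drawn from $\mathcal{L}$. A rearrangement of a tiling by $T$ is any tiling of $R_{n\times m}$ by the same multiset $T$. A tiling of $R_{n\times m}$ admits a subtiling if it has a rearrangement which is the side-by-side juxtaposition of a tiling of $R_{n\times m'}$ and a tiling of $R_{n\times m''}$ with $m=m'+m''$ and $m',m''\neq 0$. $\beta_n(\mathcal{L})$ is the smallest natural number such that every tiling of $R_{n\times m}$ by elements of $\mathcal{L}$ with $m>\beta_n(\mathcal{L})$ admits a subtiling; $\beta_n(\mathcal{L}):=\infty$ if there are tilings with $m$ arbitrarily large admitting no subtiling. $\mathcal{L}$ is called strongly $n$-Noetherian if $\beta_n(\mathcal{L})<\infty$.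
   Formalization: The equality of β_n(L) with the largest width is claimed only if some polyomino of that width occurs in a tiling of some R_{n×m} by elements of L; otherwise it fails (n=1, L one rectangle of height 2, width 5: β=0). Strong Noetherianity and β ≤ largest width need no such condition. -}

module Defs where

open import Data.List using (List; []; _∷_; _++_; map; filter; foldr)
open import Data.List.Membership.Propositional using (_∈_)
open import Data.List.Relation.Binary.Permutation.Propositional using (_↭_)
open import Data.List.Relation.Unary.All using (All)
open import Data.List.Relation.Unary.AllPairs using (AllPairs)
open import Data.List.Relation.Unary.Any using (Any)
open import Data.Nat using (ℕ; _+_; _*_; _≤_; _<_; _>_; NonZero; _≟_)
open import Data.Nat.GCD using (gcd)
open import Data.Product using (Σ-syntax; ∃; ∃-syntax; _×_)
open import Relation.Binary.PropositionalEquality using (_≡_; _≢_)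
open import Relation.Nullary using (¬_)
open import Relation.Nullary.Decidable using (¬?)
open import Relation.Nullary.Construct.Add.Supremum using (_⁺; [_]; ⊤⁺)

-- A rectangular polyomino up to translation is determined by its dimensions.
-- Positivity is irrelevant, so _≡_ compares dimensions only.
record Rect : Set where
  constructor rect
  field
    height width : ℕ
    .{{height≢0}} : NonZero height
    .{{width≢0}}  : NonZero width

open Rect public

-- The translate of a rectangle whose lower-left unit cell is (col , row).
-- Integer translates suffice: on a generic horizontal (vertical) line in a
-- tiled R_{n×m}, the tiles met have integer extents that add up consecutively
-- starting from 0, so all positions in a tiling are integers anyway.
record Placed : Set where
  constructor place
  field
    shape   : Rect
    col row : ℕ

open Placed public

Covers : Placed → ℕ → ℕ → Set
Covers p c r = (col p ≤ c × c < col p + width (shape p))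
             × (row p ≤ r × r < row p + height (shape p))

Inside : ℕ → ℕ → Placed → Set
Inside n m p = col p + width (shape p) ≤ m × row p + height (shape p) ≤ n

NonOverlapping : Placed → Placed → Set
NonOverlapping p q = ∀ c r → ¬ (Covers p c r × Covers q c r)

-- Multisets of polyominoes are lists up to _↭_.  The index n is the height
-- and m the width of the tiled rectangle.
record Tiling (n m : ℕ) (T : List Rect) : Set where
  field
    placed         : List Placed
    uses           : map shape placed ↭ T
    inside         : All (Inside n m) placed
    covering       : ∀ c r → c < m → r < n → Any (λ p → Covers p c r) placed
    nonOverlapping : AllPairs NonOverlapping placed

open Tiling public

Rearrangement : ∀ {n m T} → Tiling n m T → Set
Rearrangement {n} {m} {T} _ = Tiling n m T

shiftRight : ℕ → Placed → Placed
shiftRight k (place s c r) = place s (k + c) r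

IsJuxtaposition : ∀ {n m m′ m″ T T′ T″} →
                  Tiling n m T → Tiling n m′ T′ → Tiling n m″ T″ → Set
IsJuxtaposition {m = m} {m′} {m″} t t′ t″ =
  m ≡ m′ + m″ × placed t ↭ placed t′ ++ map (shiftRight m′) (placed t″)

AdmitsSubtiling : ∀ {n m T} → Tiling n m T → Set
AdmitsSubtiling {n} t =
  Σ[ u ∈ Rearrangement t ]
  ∃[ m′ ] ∃[ m″ ] m′ ≢ 0 × m″ ≢ 0 ×
  (∃[ T′ ] ∃[ T″ ] Σ[ t′ ∈ Tiling n m′ T′ ] Σ[ t″ ∈ Tiling n m″ T″ ]
    IsJuxtaposition u t′ t″)

-- A finite set of polyominoes is a list used only through membership, so
-- repetitions and order do not matter.
DrawnFrom : List Rect → List Rect → Set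
DrawnFrom L T = All (_∈ L) T

SubtilesBeyond : ℕ → List Rect → ℕ → Set
SubtilesBeyond n L b =
  ∀ m T (t : Tiling n m T) → DrawnFrom L T → m > b → AdmitsSubtiling t

-- β n (L) as a functional relation with values in ℕ ∪ {∞}; ∞ is ⊤⁺.
IsBeta : ℕ → List Rect → ℕ ⁺ → Set
IsBeta n L [ b ] = SubtilesBeyond n L b × (∀ b′ → SubtilesBeyond n L b′ → b ≤ b′)
IsBeta n L ⊤⁺   =
  ∀ N → ∃[ m ] ∃[ T ] Σ[ t ∈ Tiling n m T ]
    m > N × DrawnFrom L T × ¬ AdmitsSubtiling t

StronglyNoetherian : ℕ → List Rect → Set
StronglyNoetherian n L = ∃[ b ] IsBeta n L [ b ]

-- The gcd of no numbers is 0, which every number divides.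
gcdOfWidths : List Rect → ℕ
gcdOfWidths L = foldr gcd 0 (map width L)

nonUnitHeight : List Rect → List Rect
nonUnitHeight = filter (λ p → ¬? (height p ≟ 1))

IsLargestWidth : List Rect → ℕ → Set
IsLargestWidth L W = (∃[ p ] p ∈ L × width p ≡ W) × (∀ p → p ∈ L → width p ≤ W)

-- A polyomino that is in no tiling of any R_{n×m} (for instance because it is
-- taller than n) has no influence on β n (L); hence β n (L) can only equal the
-- largest width if some polyomino of that width does occur in a tiling.
WidthOccurs : ℕ → List Rect → ℕ → Set
WidthOccurs n L W =
  ∃[ m ] ∃[ T ] Tiling n m T × DrawnFrom L T × (∃[ p ] p ∈ T × width p ≡ W)

{-# OPTIONS --safe #-}
module Submission where

-- A tile higher than n/2 meets the middle row, so m is the total width of the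
-- big tiles plus a multiple of the unit tile's width w.  Hence the big tiles,
-- in any order, can be put side by side, each one completed to a full column
-- by unit tiles (w divides its width), and the rest filled with unit tiles; by
-- area this uses the original number of unit tiles.  Cutting after the first
-- column gives a subtiling as soon as m exceeds all widths.  Conversely, a tile
-- of width W forces β ≥ W, since it never gets cut.

open import Data.List using (List)
open import Data.List.Membership.Propositional using (_∈_)
open import Data.Nat using (ℕ; _*_; _<_)
open import Data.Nat.Divisibility using (_∣_)
open import Data.Product using (_×_)
open import Relation.Binary.PropositionalEquality using (_≡_; _≢_)
open import Relation.Nullary.Construct.Add.Supremum using ([_])
open import Defs

open import Data.Empty using (⊥-elim)
open import Data.List using ([]; _∷_; _++_; map; replicate)
open import Data.List.Membership.Propositional using (find)
open import Data.List.Membership.Propositional.Properties using (∈-map⁺; ∈-map⁻; ∈-++⁻; ∈-filter⁺)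
open import Data.List.Properties using (map-++; map-∘; map-cong; map-id; ++-assoc)
open import Data.List.Relation.Binary.Permutation.Propositional
  using (_↭_; ↭-refl; ↭-reflexive; ↭-sym; ↭-trans; prep; module PermutationReasoning)
open import Data.List.Relation.Binary.Permutation.Propositional.Properties
  using (∈-resp-↭; All-resp-↭; map⁺; ++⁺; ++⁺ˡ; shift; shifts)
open import Data.List.Relation.Unary.All as All using (All; []; _∷_)
import Data.List.Relation.Unary.All.Properties as All
open import Data.List.Relation.Unary.AllPairs as AllPairs using (AllPairs; []; _∷_)
import Data.List.Relation.Unary.AllPairs.Properties as AllPairs
open import Data.List.Relation.Unary.Any as Any using (Any; here; there)
import Data.List.Relation.Unary.Any.Properties as Any
open import Data.Nat
open import Data.Nat.Divisibility using (divides; 1∣_; ∣-trans; ∣-refl)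
open import Data.Nat.GCD using (gcd[m,n]∣m; gcd[m,n]∣n)
open import Data.Nat.Induction using (<-rec)
open import Data.Nat.ListAction using (sum)
open import Data.Nat.ListAction.Properties using (sum-++; sum-↭)
open import Data.Nat.Properties
open import Algebra.Properties.CommutativeSemigroup +-commutativeSemigroup using (interchange; x∙yz≈y∙xz)
open import Data.Product using (∃-syntax; _,_; proj₁; proj₂)
open import Data.Sum using (_⊎_; inj₁; inj₂; [_,_]′)
open import Function using (_∘_)
open import Relation.Binary.PropositionalEquality
  using (refl; sym; trans; cong; cong₂; subst; module ≡-Reasoning)
open import Relation.Nullary using (¬_; Dec; yes; no; contradiction)
open import Relation.Nullary.Decidable using (¬?; _×-dec_)

-- Constructing tilings

retile : ∀ {n m T T′} → T ↭ T′ → Tiling n m T → Tiling n m T′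
retile T↭T′ t = record
  { placed = placed t
  ; uses = ↭-trans (uses t) T↭T′
  ; inside = inside t
  ; covering = covering t
  ; nonOverlapping = nonOverlapping t
  }

shape-shiftRight : ∀ k ps → map shape (map (shiftRight k) ps) ≡ map shape ps
shape-shiftRight k ps = sym (map-∘ ps)

juxtapose : ∀ {n m m′ T T′} → Tiling n m T → Tiling n m′ T′ → Tiling n (m + m′) (T ++ T′)
juxtapose {n} {m} {m′} {T} {T′} t t′ = record
  { placed = ps ++ map (shiftRight m) qs
  ; uses = ↭-trans
      (↭-reflexive (trans (map-++ shape ps _) (cong (map shape ps ++_) (shape-shiftRight m qs))))
      (++⁺ (uses t) (uses t′))
  ; inside = All.++⁺
      (All.map (λ (c , r) → m≤n⇒m≤n+o m′ c , r) (inside t))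
      (All.map⁺ (All.map (λ {q} (c , r) → shiftedFits q c , r) (inside t′)))
  ; covering = cover
  ; nonOverlapping = AllPairs.++⁺ (nonOverlapping t)
      (AllPairs.map⁺ (AllPairs.map (λ {p} {q} → shiftedApart p q) (nonOverlapping t′)))
      (All.map (λ {p} (c , _) → All.map⁺ (All.universal (apart p c) qs)) (inside t))
  }
  where
  ps = placed t
  qs = placed t′

  shiftedFits : ∀ q → col q + width (shape q) ≤ m′ → m + col q + width (shape q) ≤ m + m′
  shiftedFits q le = ≤-trans (≤-reflexive (+-assoc m _ _)) (+-monoʳ-≤ m le)

  apart : ∀ p → col p + width (shape p) ≤ m → ∀ q → NonOverlapping p (shiftRight m q)
  apart p le q c r (((_ , c<) , _) , ((≤c , _) , _)) =
    <-irrefl refl (<-≤-trans c< (≤-trans le (≤-trans (m≤m+n m _) ≤c)))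

  unshift : ∀ q c r → Covers (shiftRight m q) c r → m ≤ c × Covers q (c ∸ m) r
  unshift q c r ((≤c , c<) , rows) = m≤c ,
    ( ≤-trans (≤-reflexive (sym (m+n∸m≡n m (col q)))) (∸-monoˡ-≤ m ≤c)
    , +-cancelˡ-< m _ _ (≤-trans (≤-reflexive (cong suc (m+[n∸m]≡n m≤c))) (≤-trans c< (≤-reflexive (+-assoc m _ _))))
    ) , rows
    where m≤c = ≤-trans (m≤m+n m _) ≤c

  shiftedApart : ∀ p q → NonOverlapping p q → NonOverlapping (shiftRight m p) (shiftRight m q)
  shiftedApart p q p#q c r (cp , cq) =
    p#q (c ∸ m) r (proj₂ (unshift p c r cp) , proj₂ (unshift q c r cq))

  cover : ∀ c r → c < m + m′ → r < n → Any (λ p → Covers p c r) (ps ++ map (shiftRight m) qs)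
  cover c r c< r< with c <? m
  ... | yes c<m = Any.++⁺ˡ (covering t c r c<m r<)
  ... | no c≮m = Any.++⁺ʳ ps (Any.map⁺ (Any.map (λ {q} → reshift q)
          (covering t′ (c ∸ m) r (+-cancelˡ-< m _ _ (subst (_< m + m′) (sym m+[c∸m]≡c) c<)) r<)))
    where
    m+[c∸m]≡c = m+[n∸m]≡n (≮⇒≥ c≮m)
    reshift : ∀ q → Covers q (c ∸ m) r → Covers (shiftRight m q) c r
    reshift q ((≤c , c<) , rows) =
      ( ≤-trans (+-monoʳ-≤ m ≤c) (≤-reflexive m+[c∸m]≡c)
      , ≤-trans (≤-reflexive (trans (cong suc (sym m+[c∸m]≡c)) (sym (+-suc m _))))
          (≤-trans (+-monoʳ-≤ m c<) (≤-reflexive (sym (+-assoc m _ _))))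
      ) , rows

-- Transposition turns stacking into juxtaposition.
transposeRect : Rect → Rect
transposeRect (rect h w) = rect w h

transposePlaced : Placed → Placed
transposePlaced (place s c r) = place (transposeRect s) r c

transpose : ∀ {n m T} → Tiling n m T → Tiling m n (map transposeRect T)
transpose {T = T} t = record
  { placed = map transposePlaced ps
  ; uses = ↭-trans (↭-reflexive (trans (sym (map-∘ ps)) (map-∘ ps))) (map⁺ transposeRect (uses t))
  ; inside = All.map⁺ (All.map (λ (c , r) → r , c) (inside t))
  ; covering = λ c r c< r< → Any.map⁺ (Any.map (λ (x , y) → y , x) (covering t r c r< c<))
  ; nonOverlapping = AllPairs.map⁺
      (AllPairs.map (λ p#q c r ((x , y) , (z , w)) → p#q r c ((y , x) , (w , z))) (nonOverlapping t))
  }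
  where ps = placed t

stack : ∀ {n n′ m T T′} → Tiling n m T → Tiling n′ m T′ → Tiling (n + n′) m (T ++ T′)
stack {T = T} {T′} t t′ =
  retile (↭-reflexive (begin
    map transposeRect (map transposeRect T ++ map transposeRect T′)  ≡⟨ cong (map transposeRect) (map-++ transposeRect T T′) ⟨
    map transposeRect (map transposeRect (T ++ T′))                  ≡⟨ map-∘ (T ++ T′) ⟨
    -- By eta for records, `transposeRect ∘ transposeRect` is definitionally the identity.
    map (transposeRect ∘ transposeRect) (T ++ T′)                    ≡⟨ map-id (T ++ T′) ⟩
    T ++ T′                                                          ∎))
  (transpose (juxtapose (transpose t) (transpose t′)))
  where open ≡-Reasoning

single : ∀ p → Tiling (height p) (width p) (p ∷ [])
single p = record
  { placed = place p 0 0 ∷ []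
  ; uses = ↭-refl
  ; inside = (≤-refl , ≤-refl) ∷ []
  ; covering = λ c r c< r< → here ((z≤n , c<) , (z≤n , r<))
  ; nonOverlapping = [] ∷ []
  }

zeroWidth : ∀ n → Tiling n 0 []
zeroWidth n = record
  { placed = [] ; uses = ↭-refl ; inside = [] ; covering = λ _ _ () ; nonOverlapping = [] }

zeroHeight : ∀ m → Tiling 0 m []
zeroHeight m = record
  { placed = [] ; uses = ↭-refl ; inside = [] ; covering = λ _ _ _ () ; nonOverlapping = [] }

-- Double counting

∑ : ℕ → (ℕ → ℕ) → ℕ
∑ zero    f = 0
∑ (suc n) f = f 0 + ∑ n (f ∘ suc)

∑-cong : ∀ n {f g : ℕ → ℕ} → (∀ i → i < n → f i ≡ g i) → ∑ n f ≡ ∑ n g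
∑-cong zero    eq = refl
∑-cong (suc n) eq = cong₂ _+_ (eq 0 z<s) (∑-cong n (λ i i<n → eq (suc i) (s<s i<n)))

∑-const : ∀ n x → ∑ n (λ _ → x) ≡ n * x
∑-const zero    x = refl
∑-const (suc n) x = cong (x +_) (∑-const n x)

∑-+ : ∀ n f g → ∑ n (λ i → f i + g i) ≡ ∑ n f + ∑ n g
∑-+ zero    f g = refl
∑-+ (suc n) f g = trans (cong (f 0 + g 0 +_) (∑-+ n (f ∘ suc) (g ∘ suc)))
                        (interchange (f 0) (g 0) _ _)

∑-*ˡ : ∀ n x f → ∑ n (λ i → x * f i) ≡ x * ∑ n f
∑-*ˡ zero    x f = sym (*-zeroʳ x)
∑-*ˡ (suc n) x f = trans (cong (x * f 0 +_) (∑-*ˡ n x (f ∘ suc))) (sym (*-distribˡ-+ x (f 0) _))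

∑-sum : ∀ {A : Set} n (f : A → ℕ → ℕ) xs →
        ∑ n (λ i → sum (map (λ x → f x i) xs)) ≡ sum (map (λ x → ∑ n (f x)) xs)
∑-sum n f []       = trans (∑-const n 0) (*-zeroʳ n)
∑-sum n f (x ∷ xs) = trans (∑-+ n (f x) _) (cong (∑ n (f x) +_) (∑-sum n f xs))

sum-map-cong : ∀ {A : Set} {f g : A → ℕ} {xs} → All (λ x → f x ≡ g x) xs →
               sum (map f xs) ≡ sum (map g xs)
sum-map-cong []         = refl
sum-map-cong (eq ∷ eqs) = cong₂ _+_ eq (sum-map-cong eqs)

-- The indicator function of a ≤ i < a + l at i.
interval : ℕ → ℕ → ℕ → ℕ
interval (suc a) l       zero    = 0
interval (suc a) l       (suc i) = interval a l i
interval zero    zero    i       = 0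
interval zero    (suc l) zero    = 1
interval zero    (suc l) (suc i) = interval zero l i

interval-in : ∀ a l i → a ≤ i → i < a + l → interval a l i ≡ 1
interval-in (suc a) l       (suc i) (s≤s a≤i) (s≤s i<) = interval-in a l i a≤i i<
interval-in zero    (suc l) zero    _         _        = refl
interval-in zero    (suc l) (suc i) _         (s≤s i<) = interval-in zero l i z≤n i<

interval-out : ∀ a l i → ¬ (a ≤ i × i < a + l) → interval a l i ≡ 0
interval-out (suc a) l       zero    _   = refl
interval-out (suc a) l       (suc i) out = interval-out a l i λ (p , q) → out (s≤s p , s≤s q)
interval-out zero    zero    i       _   = refl
interval-out zero    (suc l) zero    out = contradiction (z≤n , z<s) out
interval-out zero    (suc l) (suc i) out = interval-out zero l i λ (p , q) → out (z≤n , s≤s q)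

∑-interval : ∀ m a l → a + l ≤ m → ∑ m (interval a l) ≡ l
∑-interval m       zero    zero    _        = trans (∑-const m 0) (*-zeroʳ m)
∑-interval (suc m) zero    (suc l) (s≤s le) = cong suc (∑-interval m zero l le)
∑-interval (suc m) (suc a) l       (s≤s le) = ∑-interval m a l le

colAt rowAt : Placed → ℕ → ℕ
colAt p = interval (col p) (width (shape p))
rowAt p = interval (row p) (height (shape p))

-- The indicator of the cells of `p`, factored into a row and a column part so that either
-- coordinate can be summed on its own.
cellAt : Placed → ℕ → ℕ → ℕ
cellAt p c r = rowAt p r * colAt p c

covers? : ∀ p c r → Dec (Covers p c r)
covers? p c r = (col p ≤? c ×-dec c <? col p + width (shape p))
          ×-dec (row p ≤? r ×-dec r <? row p + height (shape p))

cellAt-in : ∀ p c r → Covers p c r → cellAt p c r ≡ 1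
cellAt-in p c r ((a , b) , (d , e)) =
  cong₂ _*_ (interval-in (row p) _ r d e) (interval-in (col p) _ c a b)

cellAt-out : ∀ p c r → ¬ Covers p c r → cellAt p c r ≡ 0
cellAt-out p c r out with col p ≤? c ×-dec c <? col p + width (shape p)
... | yes cols = cong (_* colAt p c) (interval-out (row p) _ r λ rows → out (cols , rows))
... | no ¬cols = trans (cong (rowAt p r *_) (interval-out (col p) _ c ¬cols)) (*-zeroʳ (rowAt p r))

uncovered : ∀ c r ps → All (λ p → ¬ Covers p c r) ps → sum (map (λ p → cellAt p c r) ps) ≡ 0
uncovered c r []       []          = refl
uncovered c r (p ∷ ps) (out ∷ outs) = cong₂ _+_ (cellAt-out p c r out) (uncovered c r ps outs)

-- Covering supplies a first tile over the cell, and disjointness makes every later indicator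
-- vanish.
coveredOnce : ∀ c r ps → Any (λ p → Covers p c r) ps → AllPairs NonOverlapping ps →
              sum (map (λ p → cellAt p c r) ps) ≡ 1
coveredOnce c r (p ∷ ps) cov (p#ps ∷ ps#) with covers? p c r
... | yes cp = cong₂ _+_ (cellAt-in p c r cp)
                 (uncovered c r ps (All.map (λ p#q cq → p#q c r (cp , cq)) p#ps))
... | no ¬cp = cong₂ _+_ (cellAt-out p c r ¬cp) (coveredOnce c r ps (Any.tail ¬cp cov) ps#)

-- The cells of one row are counted twice: tile by tile, where a tile meeting the row contributes
-- its width, and cell by cell, where each is covered once.
row-sum : ∀ {n m T} (t : Tiling n m T) r → r < n →
          sum (map (λ p → rowAt p r * width (shape p)) (placed t)) ≡ m
row-sum {n} {m} t r r<n = begin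
  sum (map (λ p → rowAt p r * width (shape p)) ps)     ≡⟨ sum-map-cong (All.map (λ {p} (le , _) → cong (rowAt p r *_) (∑-interval m (col p) _ le)) (inside t)) ⟨
  sum (map (λ p → rowAt p r * ∑ m (colAt p)) ps)       ≡⟨ cong sum (map-cong (λ p → ∑-*ˡ m (rowAt p r) (colAt p)) ps) ⟨
  sum (map (λ p → ∑ m (λ c → cellAt p c r)) ps)        ≡⟨ ∑-sum m (λ p c → cellAt p c r) ps ⟨
  ∑ m (λ c → sum (map (λ p → cellAt p c r) ps))        ≡⟨ ∑-cong m (λ c c<m → coveredOnce c r ps (covering t c r c<m r<n) (nonOverlapping t)) ⟩
  ∑ m (λ _ → 1)                                        ≡⟨ ∑-const m 1 ⟩
  m * 1                                                ≡⟨ *-identityʳ m ⟩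
  m                                                    ∎
  where
  open ≡-Reasoning
  ps = placed t

area : Rect → ℕ
area p = width p * height p

-- Summing `row-sum` over all rows counts the width of each tile as often as its height.
area-sum : ∀ {n m T} → Tiling n m T → sum (map area T) ≡ n * m
area-sum {n} {m} {T} t = begin
  sum (map area T)                                              ≡⟨ sum-↭ (map⁺ area (uses t)) ⟨
  sum (map area (map shape ps))                                 ≡⟨ cong sum (map-∘ ps) ⟨
  sum (map (λ p → width (shape p) * height (shape p)) ps)       ≡⟨ sum-map-cong (All.map (λ {p} (_ , le) → cong (width (shape p) *_) (∑-interval n (row p) _ le)) (inside t)) ⟨
  sum (map (λ p → width (shape p) * ∑ n (rowAt p)) ps)          ≡⟨ cong sum (map-cong (λ p → ∑-*ˡ n (width (shape p)) (rowAt p)) ps) ⟨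
  sum (map (λ p → ∑ n (λ r → width (shape p) * rowAt p r)) ps)  ≡⟨ ∑-sum n (λ p r → width (shape p) * rowAt p r) ps ⟨
  ∑ n (λ r → sum (map (λ p → width (shape p) * rowAt p r) ps))  ≡⟨ ∑-cong n (λ r r<n → trans (cong sum (map-cong (λ p → *-comm (width (shape p)) (rowAt p r)) ps)) (row-sum t r r<n)) ⟩
  ∑ n (λ _ → m)                                                 ≡⟨ ∑-const n m ⟩
  n * m                                                         ∎
  where
  open ≡-Reasoning
  ps = placed t

-- Subtilings

admits : ∀ {n m m′ m″ T T′ T″} (t : Tiling n m T) → m ≡ m′ + m″ → m′ ≢ 0 → m″ ≢ 0 →
         Tiling n m′ T′ → Tiling n m″ T″ → T′ ++ T″ ↭ T → AdmitsSubtiling t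
admits t refl m′≢0 m″≢0 t′ t″ T′T″↭T =
  -- `retile` leaves the placements untouched, so the rearrangement is literally the juxtaposition
  -- and `refl` and `↭-refl` suffice.
  retile T′T″↭T (juxtapose t′ t″) , _ , _ , m′≢0 , m″≢0 , _ , _ , t′ , t″ , refl , ↭-refl

juxtaposition-↭ : ∀ {n m m′ m″ T T′ T″} (t : Tiling n m T) (t′ : Tiling n m′ T′)
                  (t″ : Tiling n m″ T″) → IsJuxtaposition t t′ t″ → T ↭ T′ ++ T″
juxtaposition-↭ {m′ = m′} {T = T} {T′} {T″} t t′ t″ (_ , perm) = begin
  T                                                             ↭⟨ uses t ⟨
  map shape (placed t)                                          ↭⟨ map⁺ shape perm ⟩
  map shape (placed t′ ++ map (shiftRight m′) (placed t″))      ≡⟨ map-++ shape (placed t′) _ ⟩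
  map shape (placed t′) ++ map shape (map (shiftRight m′) (placed t″))
                                                                ≡⟨ cong (map shape (placed t′) ++_) (shape-shiftRight m′ (placed t″)) ⟩
  map shape (placed t′) ++ map shape (placed t″)                ↭⟨ ++⁺ (uses t′) (uses t″) ⟩
  T′ ++ T″                                                      ∎
  where open PermutationReasoning


shape∈ : ∀ {n m T q} (t : Tiling n m T) → q ∈ placed t → shape q ∈ T
shape∈ t q∈ = ∈-resp-↭ (uses t) (∈-map⁺ shape q∈)

placement : ∀ {n m T p} (t : Tiling n m T) → p ∈ T → ∃[ q ] q ∈ placed t × p ≡ shape q
placement t p∈T = ∈-map⁻ shape (∈-resp-↭ (↭-sym (uses t)) p∈T)

width≤ : ∀ {n m T p} → Tiling n m T → p ∈ T → width p ≤ m
width≤ t p∈T with q , q∈ , refl ← placement t p∈T =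
  ≤-trans (m≤n+m _ (col q)) (proj₁ (All.lookup (inside t) q∈))

height≤ : ∀ {n m T p} → Tiling n m T → p ∈ T → height p ≤ n
height≤ t p∈T with q , q∈ , refl ← placement t p∈T =
  ≤-trans (m≤n+m _ (row q)) (proj₂ (All.lookup (inside t) q∈))

-- A tile survives in one of the two parts of a split, so splitting repeatedly
-- confines it to a rectangle that no longer has to split.
width≤bound : ∀ {n L b p} → SubtilesBeyond n L b →
              ∀ {m T} → Tiling n m T → DrawnFrom L T → p ∈ T → width p ≤ b
width≤bound {n} {L} {b} {p} subtiles {m} {T} t = <-rec Bounded step m T t
  where
  Bounded : ℕ → Set
  Bounded m = ∀ T → Tiling n m T → DrawnFrom L T → p ∈ T → width p ≤ b

  step : ∀ m → (∀ {k} → k < m → Bounded k) → Bounded m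
  step m rec T t T⊆L p∈T with m ≤? b
  ... | yes m≤b = ≤-trans (width≤ t p∈T) m≤b
  ... | no m≰b
    with u , m′ , m″ , m′≢0 , m″≢0 , T′ , T″ , t′ , t″ , jux@(refl , _) ← subtiles m T t T⊆L (≰⇒> m≰b)
    -- Each part is strictly narrower because the other has nonzero width; the recursion follows the
    -- part that contains `p`.
    = [ rec (m<m+n m′ (n≢0⇒n>0 m″≢0)) T′ t′ (All.++⁻ˡ T′ T′T″⊆L)
      , rec (m<n+m m″ (n≢0⇒n>0 m′≢0)) T″ t″ (All.++⁻ʳ T′ T′T″⊆L)
      ]′ (∈-++⁻ T′ (∈-resp-↭ T↭T′T″ p∈T))
    where
    T↭T′T″ = juxtaposition-↭ u t′ t″ jux
    T′T″⊆L = All-resp-↭ T↭T′T″ T⊆L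

-- Big tiles meet the middle row

-- A tile higher than n/2 leaves fewer than n/2 rows below it and fewer than n/2 above it. Counting
-- rows from 0, row `⌊ n /2⌋` is therefore always hit, for either parity of `n`.
crossesMiddle : ∀ {n m} p → n < 2 * height (shape p) → Inside n m p →
                row p ≤ ⌊ n /2⌋ × ⌊ n /2⌋ < row p + height (shape p)
crossesMiddle {n} p n<2h (_ , r+h≤n) = r≤half , half<r+h
  where
  open ≤-Reasoning
  r = row p
  h = height (shape p)
  half = ⌊ n /2⌋

  2half≤n : 2 * half ≤ n
  2half≤n = begin
    half + (half + 0)  ≡⟨ cong (half +_) (+-identityʳ half) ⟩
    half + half        ≤⟨ +-monoʳ-≤ half (⌊n/2⌋≤⌈n/2⌉ n) ⟩
    half + ⌈ n /2⌉     ≡⟨ ⌊n/2⌋+⌈n/2⌉≡n n ⟩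
    n                  ∎

  n≤1+2half : n ≤ 2 * suc half
  n≤1+2half = begin
    n                          ≡⟨ ⌊n/2⌋+⌈n/2⌉≡n n ⟨
    half + ⌈ n /2⌉             ≤⟨ +-mono-≤ (n≤1+n half) (⌊n/2⌋-mono (n≤1+n (suc n))) ⟩
    suc half + suc half        ≡⟨ cong (suc half +_) (+-identityʳ (suc half)) ⟨
    2 * suc half               ∎

  r≤half : r ≤ half
  -- Everything is doubled to avoid halving an odd number; then `2 * h` cancels.
  r≤half = s≤s⁻¹ (*-cancelˡ-< 2 r (suc half) (+-cancelʳ-< (2 * h) (2 * r) _ (begin-strict
    2 * r + 2 * h             ≡⟨ *-distribˡ-+ 2 r h ⟨
    2 * (r + h)               ≤⟨ *-monoʳ-≤ 2 r+h≤n ⟩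
    n + (n + 0)               ≡⟨ cong (n +_) (+-identityʳ n) ⟩
    n + n                     <⟨ +-mono-≤-< n≤1+2half n<2h ⟩
    2 * suc half + 2 * h      ∎)))

  half<r+h : half < r + h
  half<r+h = <-≤-trans (*-cancelˡ-< 2 half h (≤-<-trans 2half≤n n<2h)) (m≤n+m h r)

covering-unique : ∀ {ps p q c r} → AllPairs NonOverlapping ps → p ∈ ps → q ∈ ps →
                  Covers p c r → Covers q c r → p ≡ q
covering-unique (_ ∷ _)     (here refl) (here refl) _  _  = refl
covering-unique (p#ps ∷ _)  (here refl) (there q∈)  cp cq = ⊥-elim (All.lookup p#ps q∈ _ _ (cp , cq))
covering-unique (q#ps ∷ _)  (there p∈)  (here refl) cp cq = ⊥-elim (All.lookup q#ps p∈ _ _ (cq , cp))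
covering-unique (_ ∷ ps#)   (there p∈)  (there q∈)  cp cq = covering-unique ps# p∈ q∈ cp cq

width>0 : ∀ p → 0 < width p
width>0 (rect h w) = >-nonZero⁻¹ w

height>0 : ∀ p → 0 < height p
height>0 (rect h w) = >-nonZero⁻¹ h

-- Two distinct big tiles in one column would both cover its middle cell.
fullHeight : ∀ {n m T p} → Tiling n m T → All (λ q → n < 2 * height q) T → p ∈ T → height p ≡ n
fullHeight {n} {m} t big p∈T with q , q∈ , refl ← placement t p∈T =
  ≤-antisym (≤-trans (m≤n+m _ (row q)) (proj₂ q-in)) (≮⇒≥ h≮n)
  where
  q-in = All.lookup (inside t) q∈
  c = col q

  q-cols : c ≤ c × c < c + width (shape q)
  q-cols = ≤-refl , m<m+n c (width>0 (shape q))

  middle : ∀ {q′} → q′ ∈ placed t → row q′ ≤ ⌊ n /2⌋ × ⌊ n /2⌋ < row q′ + height (shape q′)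
  middle {q′} q′∈ = crossesMiddle q′ (All.lookup big (shape∈ t q′∈)) (All.lookup (inside t) q′∈)

  columnCovered : ∀ r → r < n → Covers q c r
  columnCovered r r<n
    with q′ , q′∈ , cq′ ← find (covering t c r (<-≤-trans (proj₂ q-cols) (proj₁ q-in)) r<n)
    = subst (λ x → Covers x c r)
        (covering-unique (nonOverlapping t) q′∈ q∈ (proj₁ cq′ , middle q′∈) (q-cols , middle q∈))
        cq′

  h≮n : ¬ (height (shape q) < n)
  -- If the height were below `n`, `q` would cover both row 0, hence start there, and row
  -- `height (shape q)`, which lies just above its top.
  h≮n h<n = <-irrefl refl (≤-trans h<r+h (≤-reflexive (cong (_+ height (shape q)) r≡0)))
    where
    r≡0 = n≤0⇒n≡0 (proj₁ (proj₂ (columnCovered 0 (≤-trans (s≤s z≤n) h<n))))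
    h<r+h = proj₂ (proj₂ (columnCovered (height (shape q)) h<n))

-- Refilling with unit-height tiles

module Filling (w : ℕ) .{{w≢0 : NonZero w}} where

  unit : Rect
  unit = rect 1 w

  -- The number of unit tiles stays existential: it need not be tracked through the constructions,
  -- because area determines it afterwards.
  Fillable : ℕ → ℕ → List Rect → Set
  Fillable n m Bs = ∃[ k ] Tiling n m (Bs ++ replicate k unit)

  replicate-++ : ∀ j k → replicate j unit ++ replicate k unit ≡ replicate (j + k) unit
  replicate-++ zero    k = refl
  replicate-++ (suc j) k = cong (unit ∷_) (replicate-++ j k)

  merge : ∀ Bs Cs j k → (Bs ++ replicate j unit) ++ (Cs ++ replicate k unit)
                      ↭ (Bs ++ Cs) ++ replicate (j + k) unit
  merge Bs Cs j k = begin
    (Bs ++ replicate j unit) ++ (Cs ++ replicate k unit)  ≡⟨ ++-assoc Bs _ _ ⟩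
    Bs ++ replicate j unit ++ Cs ++ replicate k unit      ↭⟨ ++⁺ˡ Bs (shifts (replicate j unit) Cs) ⟩
    Bs ++ Cs ++ replicate j unit ++ replicate k unit      ≡⟨ cong (λ us → Bs ++ Cs ++ us) (replicate-++ j k) ⟩
    Bs ++ Cs ++ replicate (j + k) unit                    ≡⟨ ++-assoc Bs Cs _ ⟨
    (Bs ++ Cs) ++ replicate (j + k) unit                  ∎
    where open PermutationReasoning

  fill-juxtapose : ∀ {n m m′ Bs Cs} → Fillable n m Bs → Fillable n m′ Cs → Fillable n (m + m′) (Bs ++ Cs)
  fill-juxtapose {Bs = Bs} {Cs} (j , t) (k , t′) = j + k , retile (merge Bs Cs j k) (juxtapose t t′)

  fill-stack : ∀ {n n′ m Bs Cs} → Fillable n m Bs → Fillable n′ m Cs → Fillable (n + n′) m (Bs ++ Cs)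
  fill-stack {Bs = Bs} {Cs} (j , t) (k , t′) = j + k , retile (merge Bs Cs j k) (stack t t′)

  fill-row : ∀ k → Fillable 1 (k * w) []
  fill-row zero    = 0 , zeroWidth 1
  fill-row (suc k) = fill-juxtapose (1 , single unit) (fill-row k)

  fill-block : ∀ n k → Fillable n (k * w) []
  fill-block zero    k = 0 , zeroHeight (k * w)
  fill-block (suc n) k = fill-stack (fill-row k) (fill-block n k)

  -- The tile stands at the bottom, and each remaining row above it is filled exactly since `w`
  -- divides its width.
  fill-column : ∀ {n p} → height p ≤ n → w ∣ width p → Fillable n (width p) (p ∷ [])
  fill-column {n} {p} h≤n (divides k eq) =
    subst (λ x → Fillable x (width p) (p ∷ [])) (m+[n∸m]≡n h≤n)
      (fill-stack (0 , single p) (subst (λ x → Fillable (n ∸ height p) x []) (sym eq) (fill-block (n ∸ height p) k)))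

  fill : ∀ {n} Bs k → All (λ p → height p ≤ n × w ∣ width p) Bs → Fillable n (sum (map width Bs) + k * w) Bs
  fill {n} []       k []                = fill-block n k
  fill {n} (p ∷ Bs) k ((h≤n , w∣v) ∷ Bs-ok) =
    subst (λ x → Fillable n x (p ∷ Bs)) (sym (+-assoc (width p) _ _))
      (fill-juxtapose (fill-column h≤n w∣v) (fill Bs k Bs-ok))

  area-replicate : ∀ k → sum (map area (replicate k unit)) ≡ k * w
  area-replicate zero    = refl
  area-replicate (suc k) = cong₂ _+_ (*-identityʳ w) (area-replicate k)

  -- Both tilings have total area `n * m`, the tiles of `Bs` account for the same part of it, and
  -- each unit tile adds `w`, which is nonzero.
  unitCount-unique : ∀ {n m} Bs j k → Tiling n m (Bs ++ replicate j unit) →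
                     Tiling n m (Bs ++ replicate k unit) → j ≡ k
  unitCount-unique {n} {m} Bs j k t t′ =
    *-cancelʳ-≡ j k w (+-cancelˡ-≡ (sum (map area Bs)) _ _
      (trans (sym (total j)) (trans (area-sum t) (trans (sym (area-sum t′)) (total k)))))
    where
    open ≡-Reasoning
    total : ∀ i → sum (map area (Bs ++ replicate i unit)) ≡ sum (map area Bs) + i * w
    total i = begin
      sum (map area (Bs ++ replicate i unit))                      ≡⟨ cong sum (map-++ area Bs _) ⟩
      sum (map area Bs ++ map area (replicate i unit))             ≡⟨ sum-++ (map area Bs) _ ⟩
      sum (map area Bs) + sum (map area (replicate i unit))        ≡⟨ cong (sum (map area Bs) +_) (area-replicate i) ⟩
      sum (map area Bs) + i * w                                    ∎

  -- Two independently refilled pieces together use as many unit tiles as `t` does, by area, so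
  -- their juxtaposition is a rearrangement of `t`.
  admitsFilled : ∀ {n m m′ m″ T k} Bs Cs (t : Tiling n m T) → T ↭ (Bs ++ Cs) ++ replicate k unit →
                 m ≡ m′ + m″ → m′ ≢ 0 → m″ ≢ 0 → Fillable n m′ Bs → Fillable n m″ Cs → AdmitsSubtiling t
  admitsFilled {k = k} Bs Cs t T↭ refl m′≢0 m″≢0 (i , t′) (j , t″) =
    admits t refl m′≢0 m″≢0 t′ t″
      (↭-trans (merge Bs Cs i j) (↭-trans (↭-reflexive (cong (λ l → (Bs ++ Cs) ++ replicate l unit) i+j≡k)) (↭-sym T↭)))
    where
    i+j≡k = unitCount-unique (Bs ++ Cs) (i + j) k
              (retile (merge Bs Cs i j) (juxtapose t′ t″)) (retile T↭ t)

  -- Separating big tiles from unit tiles and cutting wide tilings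

  Big : ℕ → Rect → Set
  Big n p = n < 2 * height p × w ∣ width p

  -- `units` counts all unit tiles and `middle` only those in the middle row. The left side of
  -- `middleRow` is the one in `row-sum`, so the field becomes a formula for `m`.
  record Sorted (n m : ℕ) (ps : List Placed) : Set where
    field
      bigs         : List Rect
      units middle : ℕ
      shapes       : map shape ps ↭ bigs ++ replicate units unit
      fitting      : All (λ p → height p ≤ n × w ∣ width p) bigs
      middleRow    : sum (map (λ p → rowAt p ⌊ n /2⌋ * width (shape p)) ps)
                     ≡ sum (map width bigs) + middle * w

  sort : ∀ {n m} ps → All (Inside n m) ps → All (λ p → shape p ≡ unit ⊎ Big n (shape p)) ps → Sorted n m ps
  sort [] [] [] = record
    { bigs = [] ; units = 0 ; middle = 0 ; shapes = ↭-refl ; fitting = [] ; middleRow = refl }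
  sort {n} (p ∷ ps) (p-in ∷ ps-in) (inj₁ refl ∷ ps-ok) = record
    { bigs = bigs
    ; units = suc units
    -- The added term is 1 if this unit tile lies in the middle row and 0 otherwise.
    ; middle = rowAt p ⌊ n /2⌋ + middle
    ; shapes = ↭-trans (prep unit shapes) (↭-sym (shift unit bigs _))
    ; fitting = fitting
    ; middleRow = begin
        x * w + _                                    ≡⟨ cong (x * w +_) middleRow ⟩
        x * w + (sum (map width bigs) + middle * w)  ≡⟨ x∙yz≈y∙xz (x * w) (sum (map width bigs)) (middle * w) ⟩
        sum (map width bigs) + (x * w + middle * w)  ≡⟨ cong (sum (map width bigs) +_) (*-distribʳ-+ w x middle) ⟨
        sum (map width bigs) + (x + middle) * w      ∎
    }
    where
    open Sorted (sort ps ps-in ps-ok)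
    open ≡-Reasoning
    x = rowAt p ⌊ n /2⌋
  sort {n} (p ∷ ps) (p-in ∷ ps-in) (inj₂ (n<2h , w∣v) ∷ ps-ok) = record
    { bigs = shape p ∷ bigs
    ; units = units
    ; middle = middle
    ; shapes = prep (shape p) shapes
    ; fitting = (≤-trans (m≤n+m _ (row p)) (proj₂ p-in) , w∣v) ∷ fitting
    ; middleRow = begin
        rowAt p ⌊ n /2⌋ * v + _                  ≡⟨ cong₂ _+_ (cong (_* v) (interval-in (row p) _ _ (proj₁ crosses) (proj₂ crosses))) middleRow ⟩
        1 * v + rest                             ≡⟨ cong (_+ rest) (*-identityˡ v) ⟩
        v + rest                                 ≡⟨ +-assoc v _ _ ⟨
        v + sum (map width bigs) + middle * w    ∎
    }
    where
    open Sorted (sort ps ps-in ps-ok)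
    open ≡-Reasoning
    v = width (shape p)
    rest = sum (map width bigs) + middle * w
    crosses = crossesMiddle p n<2h p-in

  -- The middle row shows that `m` is the total width of the big tiles plus a multiple of `w`. The
  -- first column to be cut off is as wide as some tile of `T`, hence narrower than `m`, and the
  -- rest is nonempty. The bound `b` concerns only tiles of `T`, so it may later be the largest
  -- width that occurs.
  wideAdmits : ∀ {n m b T} (t : Tiling n m T) → 0 < n → All (λ p → p ≡ unit ⊎ Big n p) T →
               (∀ {p} → p ∈ T → width p ≤ b) → b < m → AdmitsSubtiling t
  wideAdmits {n@(suc _)} {m} {b} {T} t 0<n T-ok ≤b b<m =
    split bigs (↭-trans (↭-sym (uses t)) shapes) fitting
      (trans (sym (row-sum t ⌊ n /2⌋ (⌊n/2⌋<n _))) middleRow)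
    where
    s : Sorted n m (placed t)
    s = sort (placed t) (inside t) (All.tabulate λ q∈ → All.lookup T-ok (shape∈ t q∈))
    open Sorted s

    rest≢0 : ∀ {p x} → p ∈ T → m ≡ width p + x → x ≢ 0
    rest≢0 {p} p∈T m≡ refl =
      <-irrefl (sym (trans m≡ (+-identityʳ (width p)))) (≤-<-trans (≤b p∈T) b<m)

    split : ∀ Bs → T ↭ Bs ++ replicate units unit → All (λ p → height p ≤ n × w ∣ width p) Bs →
            m ≡ sum (map width Bs) + middle * w → AdmitsSubtiling t
    split (p ∷ Bs) T↭ ((h≤n , w∣v) ∷ Bs-ok) m≡ =
      admitsFilled (p ∷ []) Bs t T↭ m≡v+ (m<n⇒n≢0 (width>0 p))
        (rest≢0 (∈-resp-↭ (↭-sym T↭) (here refl)) m≡v+)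
        (fill-column h≤n w∣v) (fill Bs middle Bs-ok)
      where m≡v+ = trans m≡ (+-assoc (width p) _ _)
    -- Without big tiles the first column has width `w`. To know `w ≤ b`, a unit tile must be found
    -- in `T`: the tile over the corner cell is one.
    split [] T↭ [] = splitUnits middle
      where
      unit∈T : unit ∈ T
      unit∈T with q , q∈ , _ ← find (covering t 0 0 (≤-<-trans z≤n b<m) 0<n) =
        subst (_∈ T) (All.lookup {P = _≡ unit} (All.replicate⁺ units refl) (∈-resp-↭ T↭ (shape∈ t q∈))) (shape∈ t q∈)

      splitUnits : ∀ k → m ≡ k * w → AdmitsSubtiling t
      splitUnits zero    m≡0  = contradiction m≡0 (m<n⇒n≢0 b<m)
      splitUnits (suc k) m≡w+ =
        admitsFilled [] [] t T↭ m≡w+ (m<n⇒n≢0 (width>0 unit)) (rest≢0 unit∈T m≡w+)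
          (subst (λ x → Fillable n x []) (*-identityˡ w) (fill-block n 1)) (fill-block n k)

-- Common divisors and maxima of widths

gcdOfWidths∣width : ∀ {L p} → p ∈ L → gcdOfWidths L ∣ width p
gcdOfWidths∣width {q ∷ L} (here refl) = gcd[m,n]∣m (width q) (gcdOfWidths L)
gcdOfWidths∣width {q ∷ L} (there p∈)  = ∣-trans (gcd[m,n]∣n (width q) (gcdOfWidths L)) (gcdOfWidths∣width p∈)

-- The alternative `b ≡ 0` is the default value for the case that no element of `L` satisfies `P`.
IsMaxWidth : (Rect → Set) → List Rect → ℕ → Set
IsMaxWidth P L b = (∀ {p} → p ∈ L → P p → width p ≤ b) × (b ≡ 0 ⊎ ∃[ p ] P p × width p ≡ b)

maxWidth : ∀ {P : Rect → Set} L → (∀ {p} → p ∈ L → Dec (P p)) → ∃[ b ] IsMaxWidth P L b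
maxWidth []      P? = 0 , (λ ()) , inj₁ refl
maxWidth (q ∷ L) P? with maxWidth L (P? ∘ there) | P? (here refl)
... | b , ≤b , attained | no ¬Pq =
  b , (λ { (here refl) Pq → contradiction Pq ¬Pq ; (there p∈) → ≤b p∈ }) , attained
... | b , ≤b , attained | yes Pq with ≤-total (width q) b
...   | inj₁ q≤b = b , (λ { (here refl) _ → q≤b ; (there p∈) → ≤b p∈ }) , attained
...   | inj₂ b≤q = width q , (λ { (here refl) _ → ≤-refl ; (there p∈) Pp → ≤-trans (≤b p∈ Pp) b≤q })
                           , inj₂ (q , Pq , refl)

-- For positive `n`, the exact value of β is the largest width among the elements that occur, which
-- may be smaller than the largest width in `L`.
Occurs : ℕ → List Rect → Rect → Set
Occurs n L p = ∃[ m ] ∃[ T ] Tiling n m T × DrawnFrom L T × p ∈ T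

-- Height zero, where β is 1

flat-empty : ∀ {m T} → Tiling 0 m T → T ≡ []
flat-empty {T = []}    t = refl
flat-empty {T = p ∷ T} t = contradiction (height≤ t (here refl)) (<⇒≱ (height>0 p))

flat-subtiles : ∀ L → SubtilesBeyond 0 L 1
flat-subtiles L (suc (suc m)) T t T⊆L (s≤s (s≤s _)) with refl ← flat-empty t =
  admits t refl (λ ()) (λ ()) (zeroHeight 1) (zeroHeight (suc m)) ↭-refl

-- The empty tiling of width 1 cannot be cut, as 1 is not a sum of two nonzero numbers.
flat-minimal : ∀ L b → SubtilesBeyond 0 L b → 1 ≤ b
flat-minimal L (suc b) _ = s≤s z≤n
flat-minimal L zero subtiles with subtiles 1 [] (zeroHeight 1) [] z<s
... | _ , zero        , _     , 0≢0 , _   , _ = contradiction refl 0≢0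
... | _ , suc zero    , zero  , _   , 0≢0 , _ = contradiction refl 0≢0
... | _ , suc zero    , suc _ , _ , _ , _ , _ , _ , _ , () , _
... | _ , suc (suc _) , _     , _ , _ , _ , _ , _ , _ , () , _

-- Applying the hypotheses on the set of polyominoes

module _ (n : ℕ) (L : List Rect)
  (unit-unique : ∀ p q → p ∈ L → q ∈ L → height p ≡ 1 → height q ≡ 1 → p ≡ q)
  (big : ∀ p → p ∈ L → height p ≢ 1 → n < 2 * height p)
  (unit-divides : ∀ u → u ∈ L → height u ≡ 1 → width u ∣ gcdOfWidths (nonUnitHeight L))
  where

  -- The hypothesis on the gcd handles the tiles of other heights; a tile of unit height is `u`
  -- itself by uniqueness.
  unit∣ : ∀ {u p} → u ∈ L → height u ≡ 1 → p ∈ L → width u ∣ width p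
  unit∣ {u} {p} u∈L hu p∈L with height p ≟ 1
  ... | yes hp with refl ← unit-unique u p u∈L p∈L hu hp = ∣-refl
  ... | no ¬hp = ∣-trans (unit-divides u u∈L hu)
                   (gcdOfWidths∣width (∈-filter⁺ (λ q → ¬? (height q ≟ 1)) p∈L ¬hp))

  UnitFree : Set
  UnitFree = ∀ {p} → p ∈ L → height p ≢ 1

  unit⊎unitFree : (∃[ u ] u ∈ L × height u ≡ 1) ⊎ UnitFree
  unit⊎unitFree with Any.any? (λ p → height p ≟ 1) L
  ... | yes ∃unit = inj₁ (find ∃unit)
  ... | no ¬∃unit = inj₂ λ p∈L hp → ¬∃unit (Any.map (λ { refl → hp }) p∈L)

  wide : ∀ {b m T} (t : Tiling n m T) → 0 < n → DrawnFrom L T →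
         (∀ {p} → p ∈ T → width p ≤ b) → b < m → AdmitsSubtiling t
  wide t 0<n T⊆L ≤b b<m with unit⊎unitFree
  ... | inj₁ (u@(rect .1 w) , u∈L , refl) = wideAdmits t 0<n (All.map classify T⊆L) ≤b b<m
    where
    open Filling w
    classify : ∀ {p} → p ∈ L → p ≡ unit ⊎ Big n p
    classify {p} p∈L with height p ≟ 1
    ... | yes hp = inj₁ (unit-unique p u p∈L u∈L hp refl)
    ... | no ¬hp = inj₂ (big p p∈L ¬hp , unit∣ u∈L refl p∈L)
  -- With no unit tile in `L`, the filler width is set to 1, which divides every width. All tiles
  -- are classified as big, so the unit count is 0 and no filler tile enters the rearrangement.
  ... | inj₂ unitFree = Filling.wideAdmits 1 t 0<n
          (All.map (λ {p} p∈L → inj₂ (big p p∈L (unitFree p∈L) , 1∣ width p)) T⊆L) ≤b b<m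

  -- A tile of height `n` tiles a rectangle alone. Any other tile needs unit tiles to complete its
  -- column, and with them it occurs exactly when it is at most `n` high.
  occurs? : ∀ {p} → p ∈ L → Dec (Occurs n L p)
  occurs? {p} p∈L with height p ≟ n | unit⊎unitFree
  ... | yes refl | _ = yes (_ , _ , single p , p∈L ∷ [] , here refl)
  ... | no h≢n | inj₂ unitFree = no λ (m , T , t , T⊆L , p∈T) →
          h≢n (fullHeight t (All.map (λ {q} q∈L → big q q∈L (unitFree q∈L)) T⊆L) p∈T)
  ... | no h≢n | inj₁ (rect .1 w , u∈L , refl) with height p ≤? n
  ...   | no h≰n = no λ (m , T , t , T⊆L , p∈T) → h≰n (height≤ t p∈T)
  ...   | yes h≤n with k , t ← Filling.fill-column w {p = p} h≤n (unit∣ u∈L refl p∈L) =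
            yes (_ , _ , t , p∈L ∷ All.replicate⁺ k u∈L , here refl)

  largestSubtiles : 0 < n → ∀ {W} → IsLargestWidth L W → SubtilesBeyond n L W
  largestSubtiles 0<n (_ , ≤W) m T t T⊆L = wide t 0<n T⊆L (λ p∈T → ≤W _ (All.lookup T⊆L p∈T))

  -- The witness is the largest width of an occurring element. It suffices by `wide`, and it is
  -- least because an occurring tile of that width is never cut.
  noetherian : 0 < n → StronglyNoetherian n L
  noetherian 0<n with b , ≤b , attained ← maxWidth L occurs? = b , subtiles , minimal attained
    where
    subtiles : SubtilesBeyond n L b
    subtiles m T t T⊆L = wide t 0<n T⊆L (λ p∈T → ≤b (All.lookup T⊆L p∈T) (m , T , t , T⊆L , p∈T))

    minimal : b ≡ 0 ⊎ (∃[ p ] Occurs n L p × width p ≡ b) → ∀ b′ → SubtilesBeyond n L b′ → b ≤ b′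
    minimal (inj₁ refl) b′ _ = z≤n
    minimal (inj₂ (p , (m , T , t , T⊆L , p∈T) , refl)) b′ subtiles′ = width≤bound subtiles′ t T⊆L p∈T

theorem2p9 : (n : ℕ) (L : List Rect) →
    (∀ p q → p ∈ L → q ∈ L → height p ≡ 1 → height q ≡ 1 → p ≡ q) →
    (∀ p → p ∈ L → height p ≢ 1 → n < 2 * height p) →
    (∀ u → u ∈ L → height u ≡ 1 → width u ∣ gcdOfWidths (nonUnitHeight L)) →
    StronglyNoetherian n L ×
    (∀ W → IsLargestWidth L W →
    SubtilesBeyond n L W × (WidthOccurs n L W → IsBeta n L [ W ]))
theorem2p9 zero L _ _ _ =
  (1 , flat-subtiles L , flat-minimal L) ,
  λ { W ((p , _ , refl) , _) →
      -- Widths are positive, so `W < m` gives `1 < m`.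
      (λ m T t T⊆L W<m → flat-subtiles L m T t T⊆L (≤-<-trans (width>0 p) W<m))
    -- No tile fits into height 0, so no width occurs.
    , λ (m , T , t , _ , q , q∈T , _) → contradiction (height≤ t q∈T) (<⇒≱ (height>0 q)) }
theorem2p9 n@(suc _) L unique big unit∣gcd =
  noetherian n L unique big unit∣gcd z<s ,
  λ W largest →
    let subtiles = largestSubtiles n L unique big unit∣gcd z<s largest in
    subtiles , λ { (m , T , t , T⊆L , p , p∈T , refl) →
      -- The occurring tile of width `W` gives the lower bound on every admissible `b′`.
      subtiles , λ b′ subtiles′ → width≤bound subtiles′ t T⊆L p∈T }
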